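{- Let $\mathcal{G}(s,p)$ be the Grundy number of position $\{s,p\}$ in one-pile restricted Nim with a pass (rule sequence $f(x)=\lceil x/2\rceil$). Then: (i) $\mathcal{G}(0,0)=0$ and $\mathcal{G}(0,1)=0$. (ii) For $u\in N$, if $\mathcal{G}(u,0)=0$, then $\mathcal{G}(u,1)=1$. (iii) For $u\in N$, if $\mathcal{G}(u,0)=2$, then $\mathcal{G}(u,1)=0$. (iv) For $u,m\in N$ such that $m>1$, if $\mathcal{G}(u,0)=2m$, then $\mathcal{G}(u,1)=2m-1$. (v) For $u,m\in N$, if $\mathcal{G}(u,0)=2m-1$, then $\mathcal{G}(u,1)=2m$.
   Context: $Z_{\ge 0}$ is the set of non-negative integers and $N$ is the set of positive integers. For a set $S$ of non-negative integers, $\mathrm{mex}(S)$ is the smallest non-negative integer not in $S$. The Grundy number of a position $\mathbf{p}$ of an impartial game is defined recursively by $\mathcal{G}(\mathbf{p})=\mathrm{mex}(\{\mathcal{G}(\mathbf{h}):\mathbf{h}\in \mathrm{move}(\mathbf{p})\})$, where $\mathrm{move}(\mathbf{p})$ is the set of positions reachable from $\mathbf{p}$ in exactly one move. One-pile restricted Nim with a pass: positions are ordered pairs $\{t,p\}$ with $t\in Z_{\ge 0}$ (number of stones) and $p\in\{0,1\}$ ($p=1$ if the pass is still available, $p=0$ otherwise). If $p=1$ and $t>0$, then $\mathrm{move}(t,p)=\{\{t-v,p\}: v\in N,\ v\le\lceil t/2\rceil\}\cup\{\{t,0\}\}$. If $p=0$ or $t=0$, then $\mathrm{move}(t,p)=\{\{t-v,p\}: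 v\in N,\ v\le\lceil t/2\rceil\}$. In particular the pass is not available from the terminal position $\{0,1\}$. -}

module Defs where

open import Data.Fin using (Fin; toℕ)
open import Data.Fin.Patterns using (0F; 1F)
open import Data.List using (List; []; _∷_; _++_; [_]; map; applyUpTo)
open import Data.List.Extrema.Nat using (max; xs≤max)
open import Data.List.Membership.DecPropositional using () renaming (_∈?_ to mem?)
open import Data.List.Membership.Propositional using (_∈_; _∉_; mapWith∈)
open import Data.List.Membership.Propositional.Properties
  using (∈-map⁻; ∈-++⁻; ∈-applyUpTo⁻; mapWith∈-cong; mapWith∈≗map)
open import Data.List.Relation.Unary.All using (lookup)
open import Data.List.Relation.Unary.Any using (here)
open import Data.Nat using (ℕ; zero; suc; _+_; _∸_; _≤_; _<_; z≤n; s≤s; ⌈_/2⌉; _≟_)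
open import Data.Nat.Induction using (<-wellFounded)
open import Data.Nat.Properties
  using (+-identityʳ; +-suc; +-monoˡ-<; +-monoʳ-<; ∸-monoʳ-<; ⌈n/2⌉≤n; ≤-trans;
         ≤∧≢⇒<; 1+n≰n)
open import Data.Product using (_×_; _,_; ∃; proj₁; proj₂)
open import Data.Sum using (inj₁; inj₂)
open import Induction.WellFounded using (WellFounded; Acc; acc; module Subrelation)
open import Relation.Binary.Construct.On as On using ()
open import Relation.Binary.PropositionalEquality using (_≡_; refl; sym; trans; cong; subst)
open import Relation.Nullary using (yes; no)

IsMex : List ℕ → ℕ → Set
IsMex xs m = m ∉ xs × (∀ k → k ∉ xs → m ≤ k)

search : ∀ xs d k → d + k ∉ xs → (∀ j → j ∉ xs → k ≤ j) → ∃ (IsMex xs)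
search xs zero    k k∉  k≤ = k , k∉ , k≤
search xs (suc d) k dk∉ k≤ with mem? _≟_ k xs
... | no  k∉ = k , k∉ , k≤
... | yes k∈ = search xs d (suc k) (subst (_∉ xs) (sym (+-suc d k)) dk∉)
                 λ j j∉ → ≤∧≢⇒< (k≤ j j∉) λ { refl → j∉ k∈ }

-- The search starts at 0 and stops at the latest at 1 + max xs, which is not in xs.
mex-exists : ∀ xs → ∃ (IsMex xs)
mex-exists xs = search xs (suc (max 0 xs)) 0
  (λ b∈ → 1+n≰n (subst (_≤ max 0 xs) (+-identityʳ _) (lookup (xs≤max 0 xs) b∈)))
  λ _ _ → z≤n

mex : List ℕ → ℕ
mex xs = proj₁ (mex-exists xs)

mex-isMex : ∀ xs → IsMex xs (mex xs)
mex-isMex xs = proj₂ (mex-exists xs)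

record ImpartialGame : Set₁ where
  field
    Position   : Set
    moves      : Position → List Position
    terminates : WellFounded (λ h p → h ∈ moves p)

module Grundy (game : ImpartialGame) where
  open ImpartialGame game

  grundyAcc : ∀ p → Acc (λ h q → h ∈ moves q) p → ℕ
  grundyAcc p (acc rs) = mex (mapWith∈ (moves p) λ {h} h∈ → grundyAcc h (rs h∈))

  grundy : Position → ℕ
  grundy p = grundyAcc p (terminates p)

  grundyAcc-irrelevant : ∀ p a b → grundyAcc p a ≡ grundyAcc p b
  grundyAcc-irrelevant p (acc rs) (acc ss) =
    cong mex (mapWith∈-cong (moves p) _ _ λ {h} h∈ → grundyAcc-irrelevant h (rs h∈) (ss h∈))

  grundy-mex : ∀ p → grundy p ≡ mex (map grundy (moves p))
  grundy-mex p with terminates p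
  ... | acc rs = cong mex (trans
    (mapWith∈-cong (moves p) _ _ λ {h} h∈ → grundyAcc-irrelevant h (rs h∈) (terminates h))
    (mapWith∈≗map grundy (moves p)))

-- (t , p): t stones; the pass is still available when p is 1F and not when p is 0F.
NimPosition : Set
NimPosition = ℕ × Fin 2

-- The positions (t ∸ v , p) with 1 ≤ v ≤ ⌈ t /2⌉; here v ≤ t, so ∸ never truncates.
removals : NimPosition → List NimPosition
removals (t , p) = map (λ v → t ∸ v , p) (applyUpTo suc ⌈ t /2⌉)

passes : NimPosition → List NimPosition
passes (zero  , p)  = []
passes (suc n , 0F) = []
passes (suc n , 1F) = [ suc n , 0F ]

nimMoves : NimPosition → List NimPosition
nimMoves x = removals x ++ passes x

rank : NimPosition → ℕ
rank (t , p) = t + toℕ p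

removals-rank : ∀ {h} x → h ∈ removals x → rank h < rank x
removals-rank (t , p) h∈ with ∈-map⁻ _ h∈
... | v , v∈ , refl with ∈-applyUpTo⁻ suc v∈
... | i , i< , refl = +-monoˡ-< (toℕ p) (∸-monoʳ-< (s≤s z≤n) (≤-trans i< (⌈n/2⌉≤n t)))

passes-rank : ∀ {h} x → h ∈ passes x → rank h < rank x
passes-rank (suc n , 1F) (here refl) = +-monoʳ-< (suc n) (s≤s z≤n)

nimMoves-rank : ∀ {h} x → h ∈ nimMoves x → rank h < rank x
nimMoves-rank x h∈ with ∈-++⁻ (removals x) h∈
... | inj₁ r = removals-rank x r
... | inj₂ q = passes-rank x q

nimWithPass : ImpartialGame
nimWithPass = record
  { Position   = NimPosition
  ; moves      = nimMoves
  ; terminates = Subrelation.wellFounded (λ {_} {x} → nimMoves-rank x) (On.wellFounded rank <-wellFounded)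
  }

𝒢 : ℕ → Fin 2 → ℕ
𝒢 t p = Grundy.grundy nimWithPass (t , p)

{-# OPTIONS --safe #-}

-- Without the pass, the options of t are the s with ⌊ t /2⌋ ≤ s < t.  Inductively the Grundy
-- values on the window [k , 2k] are exactly 0 , … , k, whence 𝒢 (2k+1) 0F = k+1 and
-- 𝒢 (2k+2) 0F = 𝒢 k 0F.  For t ≥ 1 the pass applies the permutation
-- σ = (0 1 2)(3 4)(5 6)… to the Grundy value: with g = 𝒢 t 0F the mex of S, the options with
-- the pass have values σ S ∪ {g}.  This omits σ g, and every j < σ g other than g is σ i for
-- some i < g, except for j = 0 = σ 2 when g = 1; there 2 ∈ S because t ≥ 4.
module Submission where

open import Defs
open import Data.Fin.Patterns using (0F; 1F)
open import Data.List using (map)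
open import Data.List.Membership.DecPropositional using () renaming (_∈?_ to mem?)
open import Data.List.Membership.Propositional using (_∈_)
open import Data.List.Membership.Propositional.Properties
  using (∈-map⁺; ∈-map⁻; ∈-++⁺ˡ; ∈-++⁺ʳ; ∈-++⁻; ∈-applyUpTo⁺; ∈-applyUpTo⁻)
open import Data.List.Relation.Unary.Any using (here)
open import Data.Nat
open import Data.Nat.Induction using (<-rec)
open import Data.Nat.Properties
open import Data.Product using (_×_; _,_; ∃-syntax; proj₁; proj₂)
open import Data.Sum using (_⊎_; inj₁; inj₂)
open import Relation.Binary.PropositionalEquality
open import Relation.Nullary using (yes; no; contradiction)

-- The mex characterisation of Grundy values.

module GrundyProperties (game : ImpartialGame) where
  open ImpartialGame game
  open Grundy game

  grundy-isMex : ∀ p → IsMex (map grundy (moves p)) (grundy p)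
  grundy-isMex p = subst (IsMex _) (sym (grundy-mex p)) (mex-isMex _)

  option-≢ : ∀ {h p} → h ∈ moves p → grundy h ≢ grundy p
  option-≢ {p = p} h∈ eq =
    proj₁ (grundy-isMex p) (subst (_∈ _) eq (∈-map⁺ grundy h∈))

  option-hits : ∀ {p j} → j < grundy p → ∃[ h ] h ∈ moves p × grundy h ≡ j
  option-hits {p} {j} j< with mem? _≟_ j (map grundy (moves p))
  ... | no j∉ = contradiction (proj₂ (grundy-isMex p) j j∉) (<⇒≱ j<)
  ... | yes j∈ with ∈-map⁻ grundy j∈
  ...   | h , h∈ , eq = h , h∈ , sym eq

  grundy-unique : ∀ {p m} → (∀ {h} → h ∈ moves p → grundy h ≢ m) →
                  (∀ {j} → j < m → ∃[ h ] h ∈ moves p × grundy h ≡ j) → grundy p ≡ m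
  grundy-unique {p} {m} avoids hits = ≤-antisym
    (proj₂ (grundy-isMex p) m λ m∈ → let h , h∈ , eq = ∈-map⁻ grundy m∈ in avoids h∈ (sym eq))
    (≮⇒≥ λ <m → let h , h∈ , eq = hits <m in option-≢ h∈ eq)

open GrundyProperties nimWithPass

-- Moves described by intervals.

infix 4 _↝_

_↝_ : ℕ → ℕ → Set
t ↝ s = ⌊ t /2⌋ ≤ s × s < t

n∸⌊n/2⌋≡⌈n/2⌉ : ∀ n → n ∸ ⌊ n /2⌋ ≡ ⌈ n /2⌉
n∸⌊n/2⌋≡⌈n/2⌉ n = trans (cong (_∸ ⌊ n /2⌋) (sym (⌊n/2⌋+⌈n/2⌉≡n n))) (m+n∸m≡n ⌊ n /2⌋ _)

n∸⌈n/2⌉≡⌊n/2⌋ : ∀ n → n ∸ ⌈ n /2⌉ ≡ ⌊ n /2⌋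
n∸⌈n/2⌉≡⌊n/2⌋ n = trans (cong (_∸ ⌈ n /2⌉) (sym (⌊n/2⌋+⌈n/2⌉≡n n))) (m+n∸n≡m _ ⌈ n /2⌉)

⌊n/2⌋+⌊n/2⌋≤n : ∀ n → ⌊ n /2⌋ + ⌊ n /2⌋ ≤ n
⌊n/2⌋+⌊n/2⌋≤n n = ≤-trans (+-monoʳ-≤ ⌊ n /2⌋ (⌊n/2⌋≤⌈n/2⌉ n)) (≤-reflexive (⌊n/2⌋+⌈n/2⌉≡n n))

-- The number of stones to remove is `t ∸ s`; it is written `suc (t ∸ suc s)` to match the entries
-- of `applyUpTo suc`.
∈-removals⁺ : ∀ {t s} p → t ↝ s → (s , p) ∈ removals (t , p)
∈-removals⁺ {t} {s} p (≤s , s<t) =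
  subst (λ r → (r , p) ∈ removals (t , p)) t∸v≡s (∈-map⁺ _ (∈-applyUpTo⁺ suc i<))
  where
  v≡ : suc (t ∸ suc s) ≡ t ∸ s
  v≡ = sym (+-∸-assoc 1 s<t)
  t∸v≡s : t ∸ suc (t ∸ suc s) ≡ s
  t∸v≡s = trans (cong (t ∸_) v≡) (m∸[m∸n]≡n (<⇒≤ s<t))
  i< : t ∸ suc s < ⌈ t /2⌉
  i< = subst₂ _≤_ (sym v≡) (n∸⌊n/2⌋≡⌈n/2⌉ t) (∸-monoʳ-≤ t ≤s)

∈-removals⁻ : ∀ {t h} p → h ∈ removals (t , p) → ∃[ s ] t ↝ s × h ≡ (s , p)
∈-removals⁻ {t} p h∈ with ∈-map⁻ _ h∈
... | v , v∈ , refl with ∈-applyUpTo⁻ suc v∈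
... | i , i< , refl = t ∸ suc i
  , ( subst (_≤ t ∸ suc i) (n∸⌈n/2⌉≡⌊n/2⌋ t) (∸-monoʳ-≤ t i<)
    , ∸-monoʳ-< z<s (≤-trans i< (⌈n/2⌉≤n t)) )
  , refl

∈-nimMoves₀⁻ : ∀ {t h} → h ∈ nimMoves (t , 0F) → ∃[ s ] t ↝ s × h ≡ (s , 0F)
∈-nimMoves₀⁻ {t} h∈ with ∈-++⁻ (removals (t , 0F)) h∈
∈-nimMoves₀⁻         h∈ | inj₁ r = ∈-removals⁻ 0F r
∈-nimMoves₀⁻ {zero}  h∈ | inj₂ ()
∈-nimMoves₀⁻ {suc t} h∈ | inj₂ ()

∈-nimMoves₁⁻ : ∀ {t h} → h ∈ nimMoves (t , 1F) → (∃[ s ] t ↝ s × h ≡ (s , 1F)) ⊎ h ≡ (t , 0F)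
∈-nimMoves₁⁻ {t} h∈ with ∈-++⁻ (removals (t , 1F)) h∈
∈-nimMoves₁⁻         h∈ | inj₁ r = inj₁ (∈-removals⁻ 1F r)
∈-nimMoves₁⁻ {suc t} h∈ | inj₂ (here eq) = inj₂ eq

pass∈ : ∀ {t} → t ≥ 1 → (t , 0F) ∈ nimMoves (t , 1F)
pass∈ {suc t} _ = ∈-++⁺ʳ (removals (suc t , 1F)) (here refl)

𝒢-≢ : ∀ {t s} p → t ↝ s → 𝒢 s p ≢ 𝒢 t p
𝒢-≢ {t} {s} p t↝s = option-≢ {s , p} {t , p} (∈-++⁺ˡ (∈-removals⁺ p t↝s))

𝒢₀-hits : ∀ {t j} → j < 𝒢 t 0F → ∃[ s ] t ↝ s × 𝒢 s 0F ≡ j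
𝒢₀-hits {t} j< with option-hits {t , 0F} j<
... | h , h∈ , eq with ∈-nimMoves₀⁻ {t} h∈
... | s , t↝s , refl = s , t↝s , eq

-- The pass is one extra option, of value `𝒢 t 0F`: it must avoid `m` too, and may itself supply a
-- value below `m`.
𝒢₁-unique : ∀ {t m} → t ≥ 1 → (∀ {s} → t ↝ s → 𝒢 s 1F ≢ m) → 𝒢 t 0F ≢ m →
            (∀ {j} → j < m → j ≡ 𝒢 t 0F ⊎ ∃[ s ] t ↝ s × 𝒢 s 1F ≡ j) → 𝒢 t 1F ≡ m
𝒢₁-unique {t} {m} t≥1 avoids pass-avoids hits = grundy-unique {t , 1F} {m} avoids′ hits′
  where
  avoids′ : ∀ {h} → h ∈ nimMoves (t , 1F) → Grundy.grundy nimWithPass h ≢ m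
  avoids′ h∈ with ∈-nimMoves₁⁻ {t} h∈
  ... | inj₁ (s , t↝s , refl) = avoids t↝s
  ... | inj₂ refl = pass-avoids

  hits′ : ∀ {j} → j < m → ∃[ h ] h ∈ nimMoves (t , 1F) × Grundy.grundy nimWithPass h ≡ j
  hits′ j< with hits j<
  ... | inj₁ refl = (t , 0F) , pass∈ t≥1 , refl
  ... | inj₂ (s , t↝s , eq) = (s , 1F) , ∈-++⁺ˡ (∈-removals⁺ 1F t↝s) , eq

-- Grundy values without the pass.

half-even : ∀ k → ⌊ 2 + (k + k) /2⌋ ≡ suc k
half-even k = cong suc (sym (n≡⌊n+n/2⌋ k))

half-odd : ∀ k → ⌊ suc (k + k) /2⌋ ≡ k
half-odd k = sym (n≡⌈n+n/2⌉ k)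

-- Stated for an abstract g, to stand for λ t → 𝒢 t 0F: 𝒢 itself would be unfolded at great cost
-- during type checking.
module Passless (g : ℕ → ℕ) (g-≢ : ∀ {t s} → t ↝ s → g s ≢ g t)
                (g-hits : ∀ {t j} → j < g t → ∃[ s ] t ↝ s × g s ≡ j) where

  g-unique : ∀ {t m} → (∀ {s} → t ↝ s → g s ≢ m) →
             (∀ {j} → j < m → ∃[ s ] t ↝ s × g s ≡ j) → g t ≡ m
  g-unique avoids hits = ≤-antisym
    (≮⇒≥ λ m< → let s , t↝s , eq = g-hits m< in avoids t↝s eq)
    (≮⇒≥ λ <m → let s , t↝s , eq = hits <m in g-≢ t↝s eq)

  g-zero : g 0 ≡ 0
  g-zero = g-unique (λ { (_ , ()) }) λ ()

  Covers : ℕ → Set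
  Covers k = ∀ {j} → j ≤ k → ∃[ s ] k ≤ s × s ≤ k + k × g s ≡ j

  Bounded : ℕ → Set
  Bounded k = ∀ {s} → k ≤ s → s ≤ k + k → g s ≤ k

  -- The options of 2k+1 are exactly the window [k , 2k], whose values are 0 , ... , k.
  g-odd : ∀ k → Covers k → Bounded k → g (suc (k + k)) ≡ suc k
  g-odd k covers bounded = g-unique
    (λ (≤s , s<) eq → 1+n≰n (subst (_≤ k) eq
      (bounded (subst (_≤ _) (half-odd k) ≤s) (≤-pred s<))))
    (λ j< → let s , k≤s , s≤ , eq = covers (≤-pred j<) in
      s , (≤-trans (≤-reflexive (half-odd k)) k≤s , s≤s s≤) , eq)

  g-even : ∀ k → Covers k → Bounded k → g (2 + (k + k)) ≡ g k
  g-even k covers bounded = g-unique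
    -- Every option `s` of 2k+2 lies in [k+1 , 2k+1], so `k` is in turn an option of `s`.
    (λ {s} (≤s , s<) eq → g-≢
      ( ≤-trans (⌊n/2⌋-mono (≤-pred s<)) (≤-reflexive (half-odd k))
      , subst (_≤ s) (half-even k) ≤s )
      (sym eq))
    -- A value below `g k` occurs in the window [k , 2k], but not at `k` itself, hence at an option
    -- of 2k+2.
    λ {j} j< → let s , k≤s , s≤ , eq = covers (≤-trans (<⇒≤ j<) (bounded ≤-refl (m≤m+n k k))) in
      s , ( ≤-trans (≤-reflexive (half-even k)) (≤∧≢⇒< k≤s λ k≡s →
              <⇒≢ j< (trans (sym eq) (cong g (sym k≡s))))
          , s≤s (m≤n⇒m≤1+n s≤) )
        , eq

  -- Moving the window from [k , 2k] to [k+1 , 2k+2] drops `k` and adds two positions: 2k+1 brings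
  -- the new value k+1, and 2k+2 restores the lost value `g k`.
  covers-bounded : ∀ k → Covers k × Bounded k
  covers-bounded zero = (λ { z≤n → 0 , z≤n , z≤n , g-zero }) , λ { z≤n z≤n → ≤-reflexive g-zero }
  covers-bounded (suc k) with covers-bounded k
  ... | covers , bounded = covers′ , bounded′
    where
    2k+2≡ : 2 + (k + k) ≡ suc k + suc k
    2k+2≡ = cong suc (sym (+-suc k k))
    covers′ : Covers (suc k)
    covers′ {j} j≤ with m≤n⇒m<n∨m≡n j≤
    ... | inj₂ refl = suc (k + k) , s≤s (m≤m+n k k) , ≤-trans (n≤1+n _) (≤-reflexive 2k+2≡)
                    , g-odd k covers bounded
    ... | inj₁ j<1+k with covers (≤-pred j<1+k)
    ...   | s , k≤s , s≤ , eq with m≤n⇒m<n∨m≡n k≤s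
    ...     | inj₁ k<s = s , k<s , ≤-trans s≤ (≤-trans (m≤n+m _ 2) (≤-reflexive 2k+2≡)) , eq
    ...     | inj₂ refl = 2 + (k + k) , s≤s (m≤n⇒m≤1+n (m≤m+n k k)) , ≤-reflexive 2k+2≡
                        , trans (g-even k covers bounded) eq
    bounded′ : Bounded (suc k)
    bounded′ {s} k<s s≤ with m≤n⇒m<n∨m≡n (subst (s ≤_) (sym 2k+2≡) s≤)
    ... | inj₂ refl = m≤n⇒m≤1+n (≤-trans (≤-reflexive (g-even k covers bounded))
                                         (bounded ≤-refl (m≤m+n k k)))
    ... | inj₁ s<2k+2 with m≤n⇒m<n∨m≡n (≤-pred s<2k+2)
    ...   | inj₂ refl = ≤-reflexive (g-odd k covers bounded)
    ...   | inj₁ s<2k+1 = m≤n⇒m≤1+n (bounded (<⇒≤ k<s) (≤-pred s<2k+1))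

  g≡1⇒option≡2 : ∀ {t} → t ≥ 2 → g t ≡ 1 → ∃[ s ] t ↝ s × g s ≡ 2
  g≡1⇒option≡2 {1} (s≤s ())
  g≡1⇒option≡2 {2} _ g≡1 =
    contradiction (trans (sym g≡1) (let c , b = covers-bounded 0 in trans (g-even 0 c b) g-zero)) λ ()
  g≡1⇒option≡2 {3} _ g≡1 =
    contradiction (trans (sym g≡1) (let c , b = covers-bounded 1 in g-odd 1 c b)) λ ()
  g≡1⇒option≡2 {t@(suc (suc (suc (suc _))))} _ g≡1 =
    -- Since `⌊ t /2⌋ ≥ 2`, the window starting there contains the value 2; as `g t` is 1, this
    -- occurs strictly before `t`.
    let s , k≤s , s≤ , eq = proj₁ (covers-bounded ⌊ t /2⌋) (s≤s (s≤s z≤n)) in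
    s , (k≤s , ≤∧≢⇒< (≤-trans s≤ (⌊n/2⌋+⌊n/2⌋≤n t)) λ s≡t →
           contradiction (trans (sym g≡1) (trans (cong g (sym s≡t)) eq)) λ ())
      , eq

open Passless (λ t → 𝒢 t 0F) (𝒢-≢ 0F) 𝒢₀-hits using () renaming (g≡1⇒option≡2 to 𝒢₀≡1⇒option≡2)

-- The permutation `σ`, equal to `swap` shifted by 3 from 3 onwards.

swap : ℕ → ℕ
swap 0 = 1
swap 1 = 0
swap (suc (suc n)) = 2 + swap n

swap-involutive : ∀ n → swap (swap n) ≡ n
swap-involutive 0 = refl
swap-involutive 1 = refl
swap-involutive (suc (suc n)) = cong (2 +_) (swap-involutive n)

swap-≢ : ∀ n → swap n ≢ n
swap-≢ (suc (suc n)) eq = swap-≢ n (suc-injective (suc-injective eq))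

-- Apart from `n`, the values below `swap n` form complete pairs 2i , 2i+1 below `n`, and `swap`
-- preserves each pair.
swap-below : ∀ n {j} → j < swap n → j ≡ n ⊎ ∃[ i ] i < n × swap i ≡ j
swap-below 0 (s≤s z≤n) = inj₁ refl
swap-below (suc (suc n)) {0} _ = inj₂ (1 , s<s z<s , refl)
swap-below (suc (suc n)) {1} _ = inj₂ (0 , z<s , refl)
swap-below (suc (suc n)) {suc (suc j)} (s≤s (s≤s j<)) with swap-below n j<
... | inj₁ refl = inj₁ refl
... | inj₂ (i , i<n , refl) = inj₂ (2 + i , s<s (s<s i<n) , refl)

swap-even : ∀ n → swap (2 * n) ≡ suc (2 * n)
swap-even zero = refl
swap-even (suc n) rewrite +-suc n (n + 0) = cong (2 +_) (swap-even n)

swap-odd : ∀ n → swap (suc (2 * n)) ≡ 2 * n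
swap-odd n = trans (cong swap (sym (swap-even n))) (swap-involutive (2 * n))

σ : ℕ → ℕ
σ 0 = 1
σ 1 = 2
σ 2 = 0
σ (suc (suc (suc n))) = 3 + swap n

σ⁻¹ : ℕ → ℕ
σ⁻¹ 0 = 2
σ⁻¹ 1 = 0
σ⁻¹ 2 = 1
σ⁻¹ (suc (suc (suc n))) = 3 + swap n

σ⁻¹∘σ : ∀ n → σ⁻¹ (σ n) ≡ n
σ⁻¹∘σ 0 = refl
σ⁻¹∘σ 1 = refl
σ⁻¹∘σ 2 = refl
σ⁻¹∘σ (suc (suc (suc n))) = cong (3 +_) (swap-involutive n)

σ-injective : ∀ {m n} → σ m ≡ σ n → m ≡ n
σ-injective {m} {n} eq = trans (sym (σ⁻¹∘σ m)) (trans (cong σ⁻¹ eq) (σ⁻¹∘σ n))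

σ-≢ : ∀ n → σ n ≢ n
σ-≢ (suc (suc (suc n))) eq = swap-≢ n (+-cancelˡ-≡ 3 _ _ eq)

σ-below : ∀ n {j} → j < σ n → j ≡ n ⊎ (∃[ i ] i < n × σ i ≡ j) ⊎ (n ≡ 1 × j ≡ 0)
σ-below 0 (s≤s z≤n) = inj₁ refl
σ-below 1 {0} _ = inj₂ (inj₂ (refl , refl))
σ-below 1 {1} _ = inj₁ refl
σ-below 1 {suc (suc j)} (s≤s (s≤s ()))
σ-below (suc (suc (suc n))) {0} _ = inj₂ (inj₁ (2 , s<s (s<s z<s) , refl))
σ-below (suc (suc (suc n))) {1} _ = inj₂ (inj₁ (0 , z<s , refl))
σ-below (suc (suc (suc n))) {2} _ = inj₂ (inj₁ (1 , s<s z<s , refl))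
σ-below (suc (suc (suc n))) {suc (suc (suc j))} (s≤s (s≤s (s≤s j<))) with swap-below n j<
... | inj₁ refl = inj₁ refl
... | inj₂ (i , i<n , refl) = inj₂ (inj₁ (3 + i , s<s (s<s (s<s i<n)) , refl))

2*[2+m]≡4+2*m : ∀ m → 2 * (2 + m) ≡ 4 + 2 * m
2*[2+m]≡4+2*m m = *-distribˡ-+ 2 2 m

-- An even number from 4 on is 3 plus an odd number, which `swap` lowers by one; the value 2 belongs
-- to the 3-cycle instead.
σ-even : ∀ m → m > 1 → σ (2 * m) ≡ 2 * m ∸ 1
σ-even 1 (s≤s ())
σ-even (suc (suc m)) _ =
  subst (λ e → σ e ≡ e ∸ 1) (sym (2*[2+m]≡4+2*m m)) (cong (3 +_) (swap-odd m))

σ-odd : ∀ m → m ≥ 1 → σ (2 * m ∸ 1) ≡ 2 * m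
σ-odd 1 _ = refl
σ-odd (suc (suc m)) _ =
  subst (λ e → σ (e ∸ 1) ≡ e) (sym (2*[2+m]≡4+2*m m)) (cong (3 +_) (swap-even m))

-- Grundy values with the pass.

𝒢₁≡σ𝒢₀-step : ∀ {t} → t ≥ 2 → (∀ {s} → t ↝ s → 𝒢 s 1F ≡ σ (𝒢 s 0F)) → 𝒢 t 1F ≡ σ (𝒢 t 0F)
𝒢₁≡σ𝒢₀-step {t} t≥2 ih = 𝒢₁-unique {t} {σ (𝒢 t 0F)} (<⇒≤ t≥2)
  (λ t↝s eq → 𝒢-≢ 0F t↝s (σ-injective (trans (sym (ih t↝s)) eq)))
  (λ eq → σ-≢ (𝒢 t 0F) (sym eq))
  hits
  where
  lift : ∀ {i} → (∃[ s ] t ↝ s × 𝒢 s 0F ≡ i) → ∃[ s ] t ↝ s × 𝒢 s 1F ≡ σ i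
  lift (s , t↝s , eq) = s , t↝s , trans (ih t↝s) (cong σ eq)

  hits : ∀ {j} → j < σ (𝒢 t 0F) → j ≡ 𝒢 t 0F ⊎ ∃[ s ] t ↝ s × 𝒢 s 1F ≡ j
  hits j< with σ-below (𝒢 t 0F) j<
  ... | inj₁ j≡ = inj₁ j≡
  ... | inj₂ (inj₁ (i , i< , refl)) = inj₂ (lift (𝒢₀-hits {t} i<))
  -- The missing value 0 is `σ 2`, supplied by an option of passless value 2.
  ... | inj₂ (inj₂ (g≡1 , refl)) = inj₂ (lift (𝒢₀≡1⇒option≡2 t≥2 g≡1))

𝒢₁≡σ𝒢₀ : ∀ t → t ≥ 1 → 𝒢 t 1F ≡ σ (𝒢 t 0F)
𝒢₁≡σ𝒢₀ = <-rec _ step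
  where
  step : ∀ t → (∀ {s} → s < t → s ≥ 1 → 𝒢 s 1F ≡ σ (𝒢 s 0F)) → t ≥ 1 → 𝒢 t 1F ≡ σ (𝒢 t 0F)
  -- This case is computed separately because its option 0 violates the identity: `𝒢 0 1F` is 0, but
  -- `σ 0` is 1. From 2 on, every option is at least 1.
  step 1 _ _ = refl
  step (suc (suc t)) ih _ = 𝒢₁≡σ𝒢₀-step (s≤s (s≤s z≤n))
    λ (≤s , s<t) → ih s<t (≤-trans (s≤s z≤n) ≤s)

theorem3 : (𝒢 0 0F ≡ 0 × 𝒢 0 1F ≡ 0)
    × (∀ (u : ℕ) → u ≥ 1 → 𝒢 u 0F ≡ 0 → 𝒢 u 1F ≡ 1)
    × (∀ (u : ℕ) → u ≥ 1 → 𝒢 u 0F ≡ 2 → 𝒢 u 1F ≡ 0)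
    × (∀ (u m : ℕ) → u ≥ 1 → m > 1 → 𝒢 u 0F ≡ 2 * m → 𝒢 u 1F ≡ 2 * m ∸ 1)
    × (∀ (u m : ℕ) → u ≥ 1 → m ≥ 1 → 𝒢 u 0F ≡ 2 * m ∸ 1 → 𝒢 u 1F ≡ 2 * m)
theorem3 = (refl , refl)
  , (λ u u≥1 eq → trans (𝒢₁≡σ𝒢₀ u u≥1) (cong σ eq))
  , (λ u u≥1 eq → trans (𝒢₁≡σ𝒢₀ u u≥1) (cong σ eq))
  , (λ u m u≥1 m>1 eq → trans (𝒢₁≡σ𝒢₀ u u≥1) (trans (cong σ eq) (σ-even m m>1)))
  , (λ u m u≥1 m≥1 eq → trans (𝒢₁≡σ𝒢₀ u u≥1) (trans (cong σ eq) (σ-odd m m≥1)))
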